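{- Let $\mathcal L$ be a finite set of positive integers, and write $$\mathcal L_{\mathrm{even}}=\mathcal L\cap 2\mathbb N,\qquad \mathcal L_{\mathrm{odd}}=\mathcal L\setminus\mathcal L_{\mathrm{even}},\qquad e=|\mathcal L_{\mathrm{even}}|,\qquad \mathcal L_{\mathrm{odd}}+1=\{\ell+1:\ell\in\mathcal L_{\mathrm{odd}}\}.$$ There is a threshold $n_0=n_0(\mathcal L)$ such that for all $n\ge n_0$, any family $\mathcal F\subseteq 2^{[n]}$ with $|A\triangle B|\in\mathcal L$ for all distinct $A,B\in\mathcal F$ satisfies $$|\mathcal F|\le\begin{cases}\displaystyle\sum_{i=0}^{e}\binom{n-1}{i}, & \text{if }\mathcal L\subseteq 2\mathbb N,\\[10pt] \displaystyle 2\sum_{i=0}^{e}\binom{n-1}{i}, & \text{if }\mathcal L\not\subseteq 2\mathbb N.\end{cases}$$ Moreover, if $\mathcal L\not\subseteq 2\mathbb N$ and $\mathcal L_{\mathrm{odd}}+1\subseteq\mathcal L_{\mathrm{even}}$, then (for all $n\ge n_0$) every such family satisfies the tighter bound $$|\mathcal F|\le\sum_{i=0}^{e}\binom{n}{i}.$$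
   Context: Here $[n]=\{1,\dots,n\}$, $2^{[n]}$ is the family of all subsets of $[n]$, $\triangle$ denotes symmetric difference of sets, and $2\mathbb N$ is the set of even integers among the positive integers. -}

module Defs where

open import Data.Fin.Subset using (Subset; _∪_; _─_; ∣_∣)
open import Data.List.Base using (List; filter; length; map; sum; upTo)
open import Data.List.Membership.Propositional using (_∈_)
open import Data.List.Relation.Unary.All using (All)
open import Data.List.Relation.Unary.Unique.Propositional using (Unique)
open import Data.Nat.Base using (ℕ; suc; _<_)
open import Data.Nat.Combinatorics using (_C_)
open import Data.Nat.Divisibility using (_∣_; _∣?_)
open import Data.Product.Base using (_×_)
open import Relation.Binary.PropositionalEquality using (_≢_)
open import Relation.Nullary.Decidable using (¬?)

-- Finite sets of numbers, and families of subsets of [n], are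
-- repetition-free lists, so that cardinality is length.

IsFiniteSetOfPositives : List ℕ → Set
IsFiniteSetOfPositives L = Unique L × All (0 <_) L

-- 0 is also even here, but this predicate is only applied to lists of
-- positive integers.
Even : ℕ → Set
Even ℓ = 2 ∣ ℓ

evens : List ℕ → List ℕ
evens = filter (2 ∣?_)

odds : List ℕ → List ℕ
odds = filter (λ ℓ → ¬? (2 ∣? ℓ))

odds+1 : List ℕ → List ℕ
odds+1 L = map suc (odds L)

infixl 6 _△_
_△_ : ∀ {n} → Subset n → Subset n → Subset n
A △ B = (A ─ B) ∪ (B ─ A)

DistancesIn : ∀ {n} → List ℕ → List (Subset n) → Set
DistancesIn L F = ∀ {A B} → A ∈ F → B ∈ F → A ≢ B → ∣ A △ B ∣ ∈ L

-- binomialSum m e = Σ_{i=0}^{e} (m choose i), with e included.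
binomialSum : ℕ → ℕ → ℕ
binomialSum m e = sum (map (m C_) (upTo (suc e)))

{-# OPTIONS --safe #-}

-- Write χ_S(x) = (−1)^∣S ∩ x∣, so that Σᵢ χ_{i}(x) χ_{i}(y) = n − 2 ∣x △ y∣.
-- For n ≥ 2 max L the kernel K(x, y) = Π_{ℓ ∈ L} 2 (ℓ − ∣x △ y∣) is a product of
-- factors Σᵢ χ_{i}(x) χ_{i}(y) − (n − 2ℓ), hence a combination of the
-- χ_S(x) χ_S(y) with ∣S∣ ≤ k = ∣L∣ whose coefficients have sign (−1)^(k − ∣S∣).
-- Its positive part has rank at most the number of S with ∣S∣ ≤ k and
-- ∣S∣ ≡ k mod 2, which is Σ_{i ≤ k} C(n−1, i).  On a family with distances in L
-- the matrix of K is a positive multiple of the identity, so a larger family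
-- would carry a nonzero vector on which K is both positive and nonpositive.
-- This settles even L.  In general, split the family by parity; if
-- L_odd + 1 ⊆ L_even, prepend a parity bit to every set instead.
module Submission where

open import Defs
open import Data.Bool.Base using (Bool; true; false; not; _∧_; _xor_)
import Data.Bool.Properties as Boolₚ
open import Data.Bool.Properties using (not-involutive)
open import Data.Fin.Base using (Fin; zero; suc; punchIn)
open import Data.Fin.Properties using (punchInᵢ≢i)
open import Data.Fin.Subset using (Subset; ∣_∣; ⊥)
open import Data.Fin.Subset.Properties using (∣⊥∣≡0)
open import Data.Integer.Base as ℤ using (ℤ; +_; -[1+_]; 0ℤ; 1ℤ; -_; +≤+)
import Data.Integer.Properties as ℤₚ
open import Data.Integer.Tactic.RingSolver using (solve-∀)
open import Data.List.Base using (List; []; _∷_; _++_; concat; filter; length; lookup; map; upTo)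
open import Data.List.Extrema.Nat using (max; xs≤max)
open import Data.List.Membership.Propositional using (_∈_)
open import Data.List.Membership.Propositional.Properties
  using (∈-++⁺ˡ; ∈-++⁺ʳ; ∈-concat⁺′; ∈-filter⁺; ∈-filter⁻; ∈-lookup; ∈-map⁺; ∈-map⁻; ∈-upTo⁺)
open import Data.List.Properties using (length-map; length-++; map-cong)
open import Data.List.Relation.Binary.Subset.Propositional using (_⊆_)
open import Data.List.Relation.Unary.All as All using (All; []; _∷_)
open import Data.List.Relation.Unary.AllPairs using (_∷_)
open import Data.List.Relation.Unary.Any using (here; there)
open import Data.List.Relation.Unary.Unique.Propositional using (Unique)
import Data.List.Relation.Unary.Unique.Propositional.Properties as Uniqueₚ
open import Data.Nat.Base using (ℕ; zero; suc; _≤_; _<_; _+_; _*_; _∸_; z≤n; s≤s; s<s⁻¹)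
open import Data.Nat.Combinatorics using (_C_; nCk≡nC[n∸k]; nCn≡1; nCk+nC[k+1]≡[n+1]C[k+1])
open import Data.Nat.Divisibility using (_∣_; _∣?_; divides)
import Data.Nat.Properties as ℕₚ
open import Data.Nat.ListAction using (sum)
open import Data.Product.Base using (_×_; ∃-syntax; _,_; proj₁; proj₂)
open import Data.Sum.Base using (_⊎_; inj₁; inj₂)
open import Data.Vec.Base using ([]; _∷_; updateAt)
open import Data.Vec.Functional using (Vector; tail)
open import Data.Vec.Properties using (∷-injectiveʳ)
open import Function.Base using (_∘_)
open import Relation.Binary.PropositionalEquality
  using (_≡_; _≢_; refl; sym; trans; cong; cong₂; subst; module ≡-Reasoning)
open import Relation.Nullary.Decidable using (Dec; yes; no; ¬?)
open import Relation.Nullary.Negation using (¬_; contradiction)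

open import Algebra.Properties.Semiring.Sum ℤₚ.+-*-semiring
  using (∑-distrib-+; *-distribˡ-sum; *-distribʳ-sum; sum-cong-≗; sum-remove; sum-replicate-zero)
  renaming (sum to ∑)

private
  variable
    k m n : ℕ

-- Sums of integers

∑-zero : (f : Vector ℤ n) → (∀ i → f i ≡ 0ℤ) → ∑ f ≡ 0ℤ
∑-zero {n} f f≡0 = trans (sum-cong-≗ f≡0) (sum-replicate-zero n)

∑-neg : (f : Vector ℤ n) → ∑ (λ i → - f i) ≡ - ∑ f
∑-neg {n} f = begin
  ∑ (λ i → - f i)           ≡⟨ sum-cong-≗ (λ i → ℤₚ.-1*i≡-i (f i)) ⟨
  ∑ (λ i → ℤ.-1ℤ ℤ.* f i)   ≡⟨ *-distribˡ-sum ℤ.-1ℤ f ⟨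
  ℤ.-1ℤ ℤ.* ∑ f             ≡⟨ ℤₚ.-1*i≡-i (∑ f) ⟩
  - ∑ f                     ∎
  where open ≡-Reasoning

∑-single : (f : Vector ℤ n) (i : Fin n) → (∀ j → j ≢ i → f j ≡ 0ℤ) → ∑ f ≡ f i
∑-single {suc n} f i f≡0 = begin
  ∑ f                          ≡⟨ sum-remove {i = i} f ⟩
  f i ℤ.+ ∑ (f ∘ punchIn i)    ≡⟨ cong (λ x → f i ℤ.+ x) (∑-zero _ (λ j → f≡0 _ (punchInᵢ≢i i j))) ⟩
  f i ℤ.+ 0ℤ                   ≡⟨ ℤₚ.+-identityʳ (f i) ⟩
  f i                          ∎
  where open ≡-Reasoning

∑-nonneg : (f : Vector ℤ n) → (∀ i → 0ℤ ℤ.≤ f i) → 0ℤ ℤ.≤ ∑ f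
∑-nonneg {zero}  f f≥0 = ℤₚ.≤-refl
∑-nonneg {suc n} f f≥0 = ℤₚ.+-mono-≤ (f≥0 zero) (∑-nonneg (tail f) (f≥0 ∘ suc))

term≤∑ : (f : Vector ℤ n) → (∀ i → 0ℤ ℤ.≤ f i) → ∀ i → f i ℤ.≤ ∑ f
term≤∑ {suc n} f f≥0 i = begin
  f i                          ≡⟨ ℤₚ.+-identityʳ (f i) ⟨
  f i ℤ.+ 0ℤ                   ≤⟨ ℤₚ.+-monoʳ-≤ (f i) (∑-nonneg (f ∘ punchIn i) (f≥0 ∘ punchIn i)) ⟩
  f i ℤ.+ ∑ (f ∘ punchIn i)    ≡⟨ sum-remove {i = i} f ⟨
  ∑ f                          ∎
  where open ℤₚ.≤-Reasoning

0≤i*i : ∀ i → 0ℤ ℤ.≤ i ℤ.* i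
0≤i*i (+ n)    = subst (0ℤ ℤ.≤_) (ℤₚ.pos-* n n) (+≤+ z≤n)
0≤i*i -[1+ n ] = +≤+ z≤n

0<i*i : ∀ i → i ≢ 0ℤ → 0ℤ ℤ.< i ℤ.* i
0<i*i i i≢0 = ℤₚ.≤∧≢⇒< (0≤i*i i) λ 0≡i² → case (ℤₚ.i*j≡0⇒i≡0∨j≡0 i (sym 0≡i²))
  where
  case : ¬ (i ≡ 0ℤ ⊎ i ≡ 0ℤ)
  case (inj₁ eq) = i≢0 eq
  case (inj₂ eq) = i≢0 eq

-- Homogeneous linear systems

dot : Vector ℤ n → Vector ℤ n → ℤ
dot u v = ∑ (λ i → u i ℤ.* v i)

-- The order of equations is irrelevant to their solutions, so the pivot row is extracted only up to
-- a length count and an inclusion, with no permutation to track.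
findPivot : (rows : List (Vector ℤ (suc n))) →
  All (λ r → r zero ≡ 0ℤ) rows ⊎
  (∃[ r ] ∃[ rest ] r zero ≢ 0ℤ × length rows ≡ suc (length rest) × rows ⊆ r ∷ rest)
findPivot [] = inj₁ []
findPivot (s ∷ rows) with s zero ℤₚ.≟ 0ℤ | findPivot rows
... | no s₀≢0  | _ = inj₂ (s , rows , s₀≢0 , refl , λ p → p)
... | yes s₀≡0 | inj₁ zeros = inj₁ (s₀≡0 ∷ zeros)
... | yes s₀≡0 | inj₂ (r , rest , r₀≢0 , len , sub) =
  inj₂ (r , s ∷ rest , r₀≢0 , cong suc len , sub′)
  where
  sub′ : s ∷ rows ⊆ r ∷ s ∷ rest
  sub′ (here refl) = there (here refl)
  sub′ (there p) with sub p
  ... | here eq = here eq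
  ... | there q = there (there q)

-- Gaussian elimination without fractions, by induction on the number of unknowns: each step spends
-- one row and one unknown, and cross-multiplication with the pivot replaces division.
nontrivialSolution : (rows : List (Vector ℤ n)) → length rows < n →
  ∃[ v ] (∃[ i ] v i ≢ 0ℤ) × All (λ r → dot r v ≡ 0ℤ) rows
nontrivialSolution {suc n} rows len< with findPivot rows
-- The first unknown occurs in no equation, so the first unit vector is a solution.
... | inj₁ zeros = e₀ , (zero , λ ()) , All.map (λ {r} → dot-e₀ {r}) zeros
  where
  e₀ : Vector ℤ (suc n)
  e₀ zero    = 1ℤ
  e₀ (suc _) = 0ℤ

  dot-e₀ : ∀ {r} → r zero ≡ 0ℤ → dot r e₀ ≡ 0ℤ
  dot-e₀ {r} r₀≡0 = ∑-zero (λ i → r i ℤ.* e₀ i) λ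
    { zero    → trans (ℤₚ.*-identityʳ (r zero)) r₀≡0
    ; (suc i) → ℤₚ.*-zeroʳ (r (suc i)) }
... | inj₂ (r , rest , r₀≢0 , len≡ , sub) =
  v , (suc i , vᵢ≢0) , All.tabulate (λ s∈ → All.lookup (dot-r ∷ All.tabulate dot-rest) (sub s∈))
  where
  eliminate : Vector ℤ (suc n) → Vector ℤ n
  eliminate s i = r zero ℤ.* s (suc i) ℤ.- s zero ℤ.* r (suc i)

  ih = nontrivialSolution (map eliminate rest)
    (subst (_< n) (sym (length-map eliminate rest)) (s<s⁻¹ (subst (_< suc n) len≡ len<)))

  w : Vector ℤ n
  w = proj₁ ih

  i : Fin n
  i = proj₁ (proj₁ (proj₂ ih))

  -- Back substitution: solving the pivot row for the first unknown would divide by `r zero`, so the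
  -- whole vector is scaled by `r zero` instead.
  v : Vector ℤ (suc n)
  v zero    = - dot (tail r) w
  v (suc i) = r zero ℤ.* w i

  vᵢ≢0 : r zero ℤ.* w i ≢ 0ℤ
  vᵢ≢0 eq with ℤₚ.i*j≡0⇒i≡0∨j≡0 (r zero) eq
  ... | inj₁ r₀≡0 = r₀≢0 r₀≡0
  ... | inj₂ wᵢ≡0 = proj₂ (proj₁ (proj₂ ih)) wᵢ≡0

  -- Valid for every row `s`, so it serves both the pivot row, which eliminates to zero, and the
  -- remaining rows, which `ih` covers.
  dot-v : ∀ s → dot s v ≡ dot (eliminate s) w
  dot-v s = sym (begin
    ∑ (λ i → eliminate s i ℤ.* w i)
      ≡⟨ sum-cong-≗ (λ i → expand (r zero) (s (suc i)) (s zero) (r (suc i)) (w i)) ⟩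
    ∑ (λ i → - s zero ℤ.* (r (suc i) ℤ.* w i) ℤ.+ s (suc i) ℤ.* (r zero ℤ.* w i))
      ≡⟨ ∑-distrib-+ (λ i → - s zero ℤ.* (r (suc i) ℤ.* w i)) _ ⟩
    ∑ (λ i → - s zero ℤ.* (r (suc i) ℤ.* w i)) ℤ.+ dot (tail s) (tail v)
      ≡⟨ cong (ℤ._+ dot (tail s) (tail v)) (*-distribˡ-sum (- s zero) (λ i → r (suc i) ℤ.* w i)) ⟨
    - s zero ℤ.* dot (tail r) w ℤ.+ dot (tail s) (tail v)
      ≡⟨ cong (ℤ._+ dot (tail s) (tail v)) (swapNeg (s zero) (dot (tail r) w)) ⟩
    dot s v ∎)
    where
    open ≡-Reasoning
    expand : ∀ a b c d e → (a ℤ.* b ℤ.- c ℤ.* d) ℤ.* e ≡ - c ℤ.* (d ℤ.* e) ℤ.+ b ℤ.* (a ℤ.* e)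
    expand = solve-∀
    swapNeg : ∀ a b → - a ℤ.* b ≡ a ℤ.* - b
    swapNeg = solve-∀

  dot-r : dot r v ≡ 0ℤ
  dot-r = trans (dot-v r) (∑-zero _ λ i → cancel (r zero) (r (suc i)) (w i))
    where
    cancel : ∀ a b c → (a ℤ.* b ℤ.- a ℤ.* b) ℤ.* c ≡ 0ℤ
    cancel = solve-∀

  dot-rest : ∀ {s} → s ∈ rest → dot s v ≡ 0ℤ
  dot-rest {s} s∈ = trans (dot-v s) (All.lookup (proj₂ (proj₂ ih)) (∈-map⁺ eliminate s∈))

-- Characters of the cube

sgn : Bool → ℤ
sgn false = 1ℤ
sgn true  = ℤ.-1ℤ

χ : Subset n → Subset n → ℤ
χ []      []      = 1ℤ
χ (s ∷ S) (b ∷ x) = sgn (s ∧ b) ℤ.* χ S x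

χ-⊥ : (x : Subset n) → χ ⊥ x ≡ 1ℤ
χ-⊥ []      = refl
χ-⊥ (b ∷ x) = trans (ℤₚ.*-identityˡ (χ ⊥ x)) (χ-⊥ x)

flip : Fin n → Subset n → Subset n
flip i S = updateAt S i not

sgn-not-∧ : ∀ s b → sgn (not s ∧ b) ≡ sgn b ℤ.* sgn (s ∧ b)
sgn-not-∧ false false = refl
sgn-not-∧ false true  = refl
sgn-not-∧ true  false = refl
sgn-not-∧ true  true  = refl

-- The inner product of the ±1 vectors of `x` and `y`: agreeing coordinates contribute 1 and
-- differing ones -1.
correlation : Subset n → Subset n → ℤ
correlation {n} x y = + n ℤ.- + 2 ℤ.* + ∣ x △ y ∣

correlation-∷ : ∀ b c (x y : Subset n) →
  sgn b ℤ.* sgn c ℤ.+ correlation x y ≡ correlation (b ∷ x) (c ∷ y)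
correlation-∷ {n} b c x y = go b c
  where
  N D : ℤ
  N = + n
  D = + ∣ x △ y ∣
  same : ∀ N D → 1ℤ ℤ.+ (N ℤ.- + 2 ℤ.* D) ≡ (1ℤ ℤ.+ N) ℤ.- + 2 ℤ.* D
  same = solve-∀
  differ : ∀ N D → ℤ.-1ℤ ℤ.+ (N ℤ.- + 2 ℤ.* D) ≡ (1ℤ ℤ.+ N) ℤ.- + 2 ℤ.* (1ℤ ℤ.+ D)
  differ = solve-∀
  go : ∀ b c → sgn b ℤ.* sgn c ℤ.+ correlation x y ≡ correlation (b ∷ x) (c ∷ y)
  go false false = same N D
  go false true  = differ N D
  go true  false = differ N D
  go true  true  = same N D

-- Flipping `i` in `S` multiplies the character by that of {i}, so χ_S(x) χ_S(y) factors out and the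
-- correlation remains. The induction splits off one coordinate.
∑-flip : ∀ (S x y : Subset n) →
  ∑ (λ i → χ (flip i S) x ℤ.* χ (flip i S) y) ≡ correlation x y ℤ.* (χ S x ℤ.* χ S y)
∑-flip []      []      []      = refl
∑-flip (s ∷ S) (b ∷ x) (c ∷ y) = begin
  χ (not s ∷ S) (b ∷ x) ℤ.* χ (not s ∷ S) (c ∷ y) ℤ.+ ∑ (λ i → (β ℤ.* χ (flip i S) x) ℤ.* (γ ℤ.* χ (flip i S) y))
    ≡⟨ cong₂ ℤ._+_ head≡ tail≡ ⟩
  (sgn b ℤ.* X) ℤ.* (sgn c ℤ.* Y) ℤ.+ (β ℤ.* γ) ℤ.* (correlation x y ℤ.* (χ S x ℤ.* χ S y))
    ≡⟨ collect (sgn b) (sgn c) β γ (χ S x) (χ S y) (correlation x y) ⟩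
  (sgn b ℤ.* sgn c ℤ.+ correlation x y) ℤ.* (X ℤ.* Y)
    ≡⟨ cong (ℤ._* (X ℤ.* Y)) (correlation-∷ b c x y) ⟩
  correlation (b ∷ x) (c ∷ y) ℤ.* (X ℤ.* Y) ∎
  where
  open ≡-Reasoning
  β γ X Y : ℤ
  β = sgn (s ∧ b)
  γ = sgn (s ∧ c)
  X = β ℤ.* χ S x
  Y = γ ℤ.* χ S y
  flipHead : ∀ b x → χ (not s ∷ S) (b ∷ x) ≡ sgn b ℤ.* (sgn (s ∧ b) ℤ.* χ S x)
  flipHead b x = trans (cong (ℤ._* χ S x) (sgn-not-∧ s b)) (ℤₚ.*-assoc (sgn b) (sgn (s ∧ b)) (χ S x))
  head≡ = cong₂ ℤ._*_ (flipHead b x) (flipHead c y)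
  regroup : ∀ a b c d → (a ℤ.* b) ℤ.* (c ℤ.* d) ≡ (a ℤ.* c) ℤ.* (b ℤ.* d)
  regroup = solve-∀
  tail≡ : ∑ (λ i → (β ℤ.* χ (flip i S) x) ℤ.* (γ ℤ.* χ (flip i S) y)) ≡
          (β ℤ.* γ) ℤ.* (correlation x y ℤ.* (χ S x ℤ.* χ S y))
  tail≡ = begin
    ∑ (λ i → (β ℤ.* χ (flip i S) x) ℤ.* (γ ℤ.* χ (flip i S) y))
      ≡⟨ sum-cong-≗ (λ i → regroup β (χ (flip i S) x) γ (χ (flip i S) y)) ⟩
    ∑ (λ i → (β ℤ.* γ) ℤ.* (χ (flip i S) x ℤ.* χ (flip i S) y))
      ≡⟨ *-distribˡ-sum (β ℤ.* γ) (λ i → χ (flip i S) x ℤ.* χ (flip i S) y) ⟨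
    (β ℤ.* γ) ℤ.* ∑ (λ i → χ (flip i S) x ℤ.* χ (flip i S) y)
      ≡⟨ cong ((β ℤ.* γ) ℤ.*_) (∑-flip S x y) ⟩
    (β ℤ.* γ) ℤ.* (correlation x y ℤ.* (χ S x ℤ.* χ S y)) ∎
  collect : ∀ b c β γ p q r →
    (b ℤ.* (β ℤ.* p)) ℤ.* (c ℤ.* (γ ℤ.* q)) ℤ.+ (β ℤ.* γ) ℤ.* (r ℤ.* (p ℤ.* q)) ≡
    (b ℤ.* c ℤ.+ r) ℤ.* ((β ℤ.* p) ℤ.* (γ ℤ.* q))
  collect = solve-∀

-- Sizes of fixed parity

infix 4 _⊑_
-- Encodes m ≤ k together with m ≡ k mod 2, so that one induction carries both.
data _⊑_ : ℕ → ℕ → Set where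
  same : m ⊑ m
  +2   : m ⊑ k → m ⊑ suc (suc k)

suc-⊑ : m ⊑ k → suc m ⊑ suc k
suc-⊑ same   = same
suc-⊑ (+2 p) = +2 (suc-⊑ p)

pred-⊑ : suc m ⊑ k → m ⊑ suc k
pred-⊑ same   = +2 same
pred-⊑ (+2 p) = +2 (pred-⊑ p)

⊑⇒≤ : m ⊑ k → m ≤ k
⊑⇒≤ same   = ℕₚ.≤-refl
⊑⇒≤ (+2 p) = ℕₚ.m≤n⇒m≤1+n (ℕₚ.m≤n⇒m≤1+n (⊑⇒≤ p))

∣flip∣ : ∀ i (S : Subset n) → ∣ flip i S ∣ ≡ suc ∣ S ∣ ⊎ ∣ S ∣ ≡ suc ∣ flip i S ∣
∣flip∣ zero    (false ∷ S) = inj₁ refl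
∣flip∣ zero    (true  ∷ S) = inj₂ refl
∣flip∣ (suc i) (false ∷ S) = ∣flip∣ i S
∣flip∣ (suc i) (true  ∷ S) with ∣flip∣ i S
... | inj₁ eq = inj₁ (cong suc eq)
... | inj₂ eq = inj₂ (cong suc eq)

-- A flip changes the size by one, up or down; either way the parity switches and the bound k + 1
-- holds.
flip-⊑ : ∀ i (S : Subset n) → ∣ S ∣ ⊑ k → ∣ flip i S ∣ ⊑ suc k
flip-⊑ i S p with ∣flip∣ i S
... | inj₁ eq = subst (_⊑ _) (sym eq) (suc-⊑ p)
... | inj₂ eq = pred-⊑ (subst (_⊑ _) eq p)

-- Counterpart of `flip-⊑` for the opposite parity class, which carries the negative coefficients.
flip-⊑-suc : ∀ i (S : Subset n) → suc ∣ S ∣ ⊑ k → suc ∣ flip i S ∣ ⊑ suc k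
flip-⊑-suc i S p with ∣flip∣ i S
... | inj₁ eq = subst (λ m → suc m ⊑ _) (sym eq) (suc-⊑ p)
... | inj₂ eq = pred-⊑ (subst (λ m → suc m ⊑ _) eq p)

-- Kernels with alternating spectrum

Kernel : ℕ → Set
Kernel n = Subset n → Subset n → ℤ

χχ : Subset n → Kernel n
χχ S x y = χ S x ℤ.* χ S y

-- The cone generated by the signed rank-one kernels. Natural coefficients arise as repeated sums,
-- and `resp` makes membership depend only on the values of a kernel.
data Alternating {n} : ℕ → Kernel n → Set where
  plus  : ∀ S → ∣ S ∣ ⊑ k → Alternating k (χχ S)
  minus : ∀ S → suc ∣ S ∣ ⊑ k → Alternating k (λ x y → - χχ S x y)
  none  : Alternating k (λ _ _ → 0ℤ)
  add   : ∀ {K K′} → Alternating k K → Alternating k K′ → Alternating k (λ x y → K x y ℤ.+ K′ x y)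
  resp  : ∀ {K K′} → (∀ x y → K x y ≡ K′ x y) → Alternating k K → Alternating k K′

alternating-∑ : (K : Fin m → Kernel n) → (∀ i → Alternating k (K i)) →
  Alternating k (λ x y → ∑ (λ i → K i x y))
alternating-∑ {zero}  K alt = none
alternating-∑ {suc m} K alt = add (alt zero) (alternating-∑ (K ∘ suc) (alt ∘ suc))

alternating-* : ∀ m {K : Kernel n} → Alternating k K → Alternating k (λ x y → + m ℤ.* K x y)
alternating-* zero    {K} alt = resp (λ x y → sym (ℤₚ.*-zeroˡ (K x y))) none
alternating-* (suc m) {K} alt =
  resp (λ x y → distrib (K x y) (+ m)) (add alt (alternating-* m alt))
  where
  distrib : ∀ a m → a ℤ.+ m ℤ.* a ≡ (1ℤ ℤ.+ m) ℤ.* a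
  distrib = solve-∀

-- Multiplying χχ S by the i-th summand of the correlation gives χχ (S △ {i}), whose
-- size has the other parity; m is n − 2ℓ, and its sign is what needs n ≥ 2ℓ.
alternating-step : ∀ m {K : Kernel n} → Alternating k K →
  Alternating (suc k) (λ x y → (correlation x y ℤ.- + m) ℤ.* K x y)
alternating-step m (plus S p) =
  resp (λ x y → trans (cong (ℤ._+ + m ℤ.* - χχ S x y) (∑-flip S x y))
                      (collect (correlation x y) (χχ S x y) (+ m)))
    (add (alternating-∑ _ (λ i → plus (flip i S) (flip-⊑ i S p)))
         (alternating-* m (minus S (suc-⊑ p))))
  where
  collect : ∀ c a m → c ℤ.* a ℤ.+ m ℤ.* - a ≡ (c ℤ.- m) ℤ.* a
  collect = solve-∀
alternating-step m (minus S p) =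
  resp (λ x y → trans (cong (ℤ._+ + m ℤ.* χχ S x y)
                        (trans (∑-neg (λ i → χχ (flip i S) x y)) (cong -_ (∑-flip S x y))))
                      (collect (correlation x y) (χχ S x y) (+ m)))
    (add (alternating-∑ _ (λ i → minus (flip i S) (flip-⊑-suc i S p)))
         (alternating-* m (plus S (pred-⊑ p))))
  where
  collect : ∀ c a m → - (c ℤ.* a) ℤ.+ m ℤ.* a ≡ (c ℤ.- m) ℤ.* - a
  collect = solve-∀
alternating-step m none = resp (λ x y → sym (ℤₚ.*-zeroʳ (correlation x y ℤ.- + m))) none
alternating-step m (add {K = K} {K′} alt alt′) =
  resp (λ x y → sym (ℤₚ.*-distribˡ-+ (correlation x y ℤ.- + m) (K x y) (K′ x y)))
    (add (alternating-step m alt) (alternating-step m alt′))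
alternating-step m (resp eq alt) =
  resp (λ x y → cong ((correlation x y ℤ.- + m) ℤ.*_) (eq x y)) (alternating-step m alt)

-- The factor 2 makes each factor at d = ∣x △ y∣ equal to the correlation minus n - 2ℓ, so all
-- coefficients stay integral.
annihilator : List ℕ → ℕ → ℤ
annihilator []      d = 1ℤ
annihilator (ℓ ∷ L) d = + 2 ℤ.* (+ ℓ ℤ.- + d) ℤ.* annihilator L d

annihilator-root : ∀ {L d} → d ∈ L → annihilator L d ≡ 0ℤ
annihilator-root {ℓ ∷ L} (here refl) = root (+ ℓ) (annihilator L ℓ)
  where
  root : ∀ a b → + 2 ℤ.* (a ℤ.- a) ℤ.* b ≡ 0ℤ
  root = solve-∀
annihilator-root {ℓ ∷ L} {d} (there d∈L) =
  trans (cong (+ 2 ℤ.* (+ ℓ ℤ.- + d) ℤ.*_) (annihilator-root d∈L)) (ℤₚ.*-zeroʳ (+ 2 ℤ.* (+ ℓ ℤ.- + d)))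

annihilator-pos : ∀ {L} → All (0 <_) L → 0ℤ ℤ.< annihilator L 0
annihilator-pos [] = ℤ.+<+ (s≤s z≤n)
annihilator-pos {suc ℓ ∷ L} (_ ∷ L>0) =
  subst (ℤ._< annihilator (suc ℓ ∷ L) 0) (ℤₚ.*-zeroʳ (+ 2 ℤ.* (+ suc ℓ ℤ.- 0ℤ)))
    (ℤₚ.*-monoˡ-<-pos (+ 2 ℤ.* (+ suc ℓ ℤ.- 0ℤ)) (annihilator-pos L>0))

annihilator-alternating : ∀ {L} → All (λ ℓ → 2 * ℓ ≤ n) L →
  Alternating {n} (length L) (λ x y → annihilator L ∣ x △ y ∣)
annihilator-alternating {n} [] =
  -- The empty product is the constant kernel 1, given by the character of the empty set.
  resp (λ x y → cong₂ ℤ._*_ (χ-⊥ x) (χ-⊥ y)) (plus ⊥ (subst (_⊑ 0) (sym (∣⊥∣≡0 n)) same))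
annihilator-alternating {n} {ℓ ∷ L} (2ℓ≤n ∷ bounds) =
  resp (λ x y → cong (ℤ._* annihilator L ∣ x △ y ∣) (factor x y))
    -- The truncated difference is the true one because 2ℓ ≤ n; this is the only use of the size of
    -- n.
    (alternating-step (n ∸ 2 * ℓ) (annihilator-alternating bounds))
  where
  shift : ∀ m l d → (m ℤ.+ + 2 ℤ.* l ℤ.- + 2 ℤ.* d) ℤ.- m ≡ + 2 ℤ.* (l ℤ.- d)
  shift = solve-∀
  n≡ : + n ≡ + (n ∸ 2 * ℓ) ℤ.+ + 2 ℤ.* + ℓ
  n≡ = trans (cong +_ (sym (ℕₚ.m∸n+n≡m 2ℓ≤n))) (cong (λ t → + (n ∸ 2 * ℓ) ℤ.+ t) (ℤₚ.pos-* 2 ℓ))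
  factor : ∀ x y → correlation x y ℤ.- + (n ∸ 2 * ℓ) ≡ + 2 ℤ.* (+ ℓ ℤ.- + ∣ x △ y ∣)
  factor x y = trans (cong (λ N → N ℤ.- + 2 ℤ.* + ∣ x △ y ∣ ℤ.- + (n ∸ 2 * ℓ)) n≡)
                     (shift (+ (n ∸ 2 * ℓ)) (+ ℓ) (+ ∣ x △ y ∣))

-- Quadratic forms

module _ {N n} (A : Fin N → Subset n) (v : Vector ℤ N) where

  form : Kernel n → ℤ
  form K = ∑ (λ i → ∑ (λ j → (v i ℤ.* v j) ℤ.* K (A i) (A j)))

  form-cong : ∀ {K K′} → (∀ x y → K x y ≡ K′ x y) → form K ≡ form K′
  form-cong eq = sum-cong-≗ λ i → sum-cong-≗ λ j → cong ((v i ℤ.* v j) ℤ.*_) (eq (A i) (A j))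

  form-+ : ∀ K K′ → form (λ x y → K x y ℤ.+ K′ x y) ≡ form K ℤ.+ form K′
  form-+ K K′ = trans
    (sum-cong-≗ λ i → trans
      (sum-cong-≗ λ j → ℤₚ.*-distribˡ-+ (v i ℤ.* v j) (K (A i) (A j)) (K′ (A i) (A j)))
      (∑-distrib-+ (λ j → (v i ℤ.* v j) ℤ.* K (A i) (A j)) _))
    (∑-distrib-+ (λ i → ∑ (λ j → (v i ℤ.* v j) ℤ.* K (A i) (A j))) _)

  form-neg : ∀ K → form (λ x y → - K x y) ≡ - form K
  form-neg K = trans
    (sum-cong-≗ λ i → trans
      (sum-cong-≗ λ j → sym (ℤₚ.neg-distribʳ-* (v i ℤ.* v j) (K (A i) (A j))))
      (∑-neg (λ j → (v i ℤ.* v j) ℤ.* K (A i) (A j))))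
    (∑-neg (λ i → ∑ (λ j → (v i ℤ.* v j) ℤ.* K (A i) (A j))))

  characterSum : Subset n → ℤ
  characterSum S = dot (χ S ∘ A) v

  -- The matrix of `χχ S` on the family is an outer product of a vector with itself, so its form is
  -- a perfect square.
  form-χχ : ∀ S → form (χχ S) ≡ characterSum S ℤ.* characterSum S
  form-χχ S = begin
    ∑ (λ i → ∑ (λ j → (v i ℤ.* v j) ℤ.* (χ S (A i) ℤ.* χ S (A j))))
      ≡⟨ sum-cong-≗ (λ i → sum-cong-≗ λ j → regroup (v i) (v j) (χ S (A i)) (χ S (A j))) ⟩
    ∑ (λ i → ∑ (λ j → t i ℤ.* t j))
      ≡⟨ sum-cong-≗ (λ i → *-distribˡ-sum (t i) t) ⟨
    ∑ (λ i → t i ℤ.* ∑ t)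
      ≡⟨ *-distribʳ-sum (∑ t) t ⟨
    ∑ t ℤ.* ∑ t ∎
    where
    open ≡-Reasoning
    t : Vector ℤ N
    t i = χ S (A i) ℤ.* v i
    regroup : ∀ a b c d → (a ℤ.* b) ℤ.* (c ℤ.* d) ≡ (c ℤ.* a) ℤ.* (d ℤ.* b)
    regroup = solve-∀

  -- A vector orthogonal to every character of the positive class kills the positive generators, and
  -- each negative generator contributes minus a square.
  form-nonpos : ∀ {K} → Alternating k K → (∀ S → ∣ S ∣ ⊑ k → characterSum S ≡ 0ℤ) → form K ℤ.≤ 0ℤ
  form-nonpos (plus S p) vanish =
    ℤₚ.≤-reflexive (trans (form-χχ S) (cong (λ c → c ℤ.* c) (vanish S p)))
  form-nonpos (minus S _) vanish =
    subst (ℤ._≤ 0ℤ) (sym (trans (form-neg (χχ S)) (cong -_ (form-χχ S))))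
      (ℤₚ.neg-mono-≤ (0≤i*i (characterSum S)))
  form-nonpos none vanish =
    ℤₚ.≤-reflexive (∑-zero _ λ i → ∑-zero _ λ j → ℤₚ.*-zeroʳ (v i ℤ.* v j))
  form-nonpos (add {K = K} {K′} alt alt′) vanish =
    subst (ℤ._≤ 0ℤ) (sym (form-+ K K′)) (ℤₚ.+-mono-≤ (form-nonpos alt vanish) (form-nonpos alt′ vanish))
  form-nonpos (resp eq alt) vanish = subst (ℤ._≤ 0ℤ) (form-cong eq) (form-nonpos alt vanish)

  form-diagonal : ∀ {K c} → (∀ i → K (A i) (A i) ≡ c) → (∀ i j → j ≢ i → K (A i) (A j) ≡ 0ℤ) →
    form K ≡ dot v v ℤ.* c
  form-diagonal {K} {c} diag off = trans
    (sum-cong-≗ λ i → trans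
      (∑-single _ i (λ j j≢i → trans (cong ((v i ℤ.* v j) ℤ.*_) (off i j j≢i)) (ℤₚ.*-zeroʳ (v i ℤ.* v j))))
      (cong ((v i ℤ.* v i) ℤ.*_) (diag i)))
    (sym (*-distribʳ-sum c (λ i → v i ℤ.* v i)))

dot-self-pos : (v : Vector ℤ n) (i : Fin n) → v i ≢ 0ℤ → 0ℤ ℤ.< dot v v
dot-self-pos v i vᵢ≢0 = ℤₚ.<-≤-trans (0<i*i (v i) vᵢ≢0) (term≤∑ _ (λ j → 0≤i*i (v j)) i)

-- Counting

-- The recursion is Pascal's rule, so the lengths follow the recurrence of `_C_`.
subsetsOfSize : ∀ (n k : ℕ) → List (Subset n)
subsetsOfSize zero    zero    = [] ∷ []
subsetsOfSize zero    (suc k) = []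
subsetsOfSize (suc n) zero    = ⊥ ∷ []
subsetsOfSize (suc n) (suc k) = map (true ∷_) (subsetsOfSize n k) ++ map (false ∷_) (subsetsOfSize n (suc k))

length-subsetsOfSize : ∀ (n k : ℕ) → length (subsetsOfSize n k) ≡ n C k
length-subsetsOfSize zero    zero    = refl
length-subsetsOfSize zero    (suc k) = refl
length-subsetsOfSize (suc n) zero    = sym (trans (nCk≡nC[n∸k] {0} {suc n} z≤n) (nCn≡1 (suc n)))
length-subsetsOfSize (suc n) (suc k) = begin
  length (map (true ∷_) (subsetsOfSize n k) ++ map (false ∷_) (subsetsOfSize n (suc k)))
    ≡⟨ length-++ (map (true ∷_) (subsetsOfSize n k)) ⟩
  length (map (true ∷_) (subsetsOfSize n k)) + length (map (false ∷_) (subsetsOfSize n (suc k)))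
    ≡⟨ cong₂ _+_ (trans (length-map (true ∷_) (subsetsOfSize n k)) (length-subsetsOfSize n k))
                 (trans (length-map (false ∷_) (subsetsOfSize n (suc k))) (length-subsetsOfSize n (suc k))) ⟩
  n C k + n C suc k
    ≡⟨ nCk+nC[k+1]≡[n+1]C[k+1] n k ⟩
  suc n C suc k ∎
  where open ≡-Reasoning

∣S∣≡0⇒S≡⊥ : (S : Subset n) → ∣ S ∣ ≡ 0 → S ≡ ⊥
∣S∣≡0⇒S≡⊥ []          _  = refl
∣S∣≡0⇒S≡⊥ (false ∷ S) eq = cong (false ∷_) (∣S∣≡0⇒S≡⊥ S eq)

∈-subsetsOfSize : ∀ k (S : Subset n) → ∣ S ∣ ≡ k → S ∈ subsetsOfSize n k
∈-subsetsOfSize zero    []          eq = here refl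
∈-subsetsOfSize zero    (b ∷ S)     eq = here (∣S∣≡0⇒S≡⊥ (b ∷ S) eq)
∈-subsetsOfSize (suc k) (true ∷ S)  eq = ∈-++⁺ˡ (∈-map⁺ (true ∷_) (∈-subsetsOfSize k S (ℕₚ.suc-injective eq)))
∈-subsetsOfSize {suc n} (suc k) (false ∷ S) eq =
  ∈-++⁺ʳ (map (true ∷_) (subsetsOfSize n k)) (∈-map⁺ (false ∷_) (∈-subsetsOfSize (suc k) S eq))

length-concat-map : ∀ {A B : Set} (f : A → List B) xs →
  length (concat (map f xs)) ≡ sum (map (length ∘ f) xs)
length-concat-map f []       = refl
length-concat-map f (x ∷ xs) = trans (length-++ (f x) {concat (map f xs)}) (cong (λ m → length (f x) + m) (length-concat-map f xs))

subsetsUpTo : ∀ (n k : ℕ) → List (Subset n)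
subsetsUpTo n k = concat (map (subsetsOfSize n) (upTo (suc k)))

length-subsetsUpTo : ∀ (n k : ℕ) → length (subsetsUpTo n k) ≡ binomialSum n k
length-subsetsUpTo n k = trans (length-concat-map (subsetsOfSize n) (upTo (suc k)))
  (cong sum (map-cong (length-subsetsOfSize n) (upTo (suc k))))

∈-subsetsUpTo : ∀ (S : Subset n) → ∣ S ∣ ≤ k → S ∈ subsetsUpTo n k
∈-subsetsUpTo {n} S ∣S∣≤k =
  ∈-concat⁺′ (∈-subsetsOfSize ∣ S ∣ S refl) (∈-map⁺ (subsetsOfSize n) (∈-upTo⁺ (s≤s ∣S∣≤k)))

-- Parity and completion of sets

odd : ℕ → Bool
odd zero    = false
odd (suc n) = not (odd n)

odd-⊑ : m ⊑ k → odd m ≡ odd k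
odd-⊑ same   = refl
odd-⊑ (+2 p) = trans (odd-⊑ p) (sym (not-involutive _))

2∣⇒¬odd : 2 ∣ n → odd n ≡ false
2∣⇒¬odd (divides zero    refl) = refl
2∣⇒¬odd (divides (suc q) refl) = trans (not-involutive _) (2∣⇒¬odd (divides q refl))

¬odd⇒2∣ : ∀ n → odd n ≡ false → 2 ∣ n
¬odd⇒2∣ zero          _  = divides 0 refl
¬odd⇒2∣ (suc (suc n)) eq with ¬odd⇒2∣ n (trans (sym (not-involutive _)) eq)
... | divides q n≡ = divides (suc q) (cong (λ m → suc (suc m)) n≡)

-- The sets S ⊆ [n+1] with ∣S∣ ⊑ k are determined by their trace on [n].
completeParity : ℕ → Subset n → Subset (suc n)
completeParity k S = (odd k xor odd ∣ S ∣) ∷ S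

∷≡completeParity : ∀ b (S : Subset n) → ∣ b ∷ S ∣ ⊑ k → b ∷ S ≡ completeParity k S
∷≡completeParity {k = k} b S p = cong (_∷ S) (go b (odd-⊑ p))
  where
  go : ∀ b → odd ∣ b ∷ S ∣ ≡ odd k → b ≡ odd k xor odd ∣ S ∣
  go false eq = trans (sym (Boolₚ.xor-same (odd k))) (cong (odd k xor_) (sym eq))
  go true  eq rewrite sym eq with odd ∣ S ∣
  ... | true  = refl
  ... | false = refl

∣S∣≤∣b∷S∣ : ∀ b (S : Subset n) → ∣ S ∣ ≤ ∣ b ∷ S ∣
∣S∣≤∣b∷S∣ true  S = ℕₚ.n≤1+n ∣ S ∣
∣S∣≤∣b∷S∣ false S = ℕₚ.≤-refl

-- The bound for a single distance set

lookup-injective : ∀ {A : Set} {xs : List A} → Unique xs → ∀ i j → lookup xs i ≡ lookup xs j → i ≡ j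
lookup-injective (_ ∷ _)       zero    zero    _  = refl
lookup-injective (x∉ ∷ _)      zero    (suc j) eq = contradiction eq (All.lookup x∉ (∈-lookup j))
lookup-injective (x∉ ∷ _)      (suc i) zero    eq = contradiction (sym eq) (All.lookup x∉ (∈-lookup i))
lookup-injective (_ ∷ unique)  (suc i) (suc j) eq = cong suc (lookup-injective unique i j eq)

∣x△x∣≡0 : (x : Subset n) → ∣ x △ x ∣ ≡ 0
∣x△x∣≡0 []          = refl
∣x△x∣≡0 (true ∷ x)  = ∣x△x∣≡0 x
∣x△x∣≡0 (false ∷ x) = ∣x△x∣≡0 x

-- A family larger than the number of test characters admits a nonzero vector orthogonal to all of
-- them, at which the form is nonpositive by its spectrum and positive by its diagonal. The ground
-- set has n + 1 points, so the sum runs over n without subtraction.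
length≤binomialSum : ∀ {n L} → All (0 <_) L → All (λ ℓ → 2 * ℓ ≤ suc n) L →
  (F : List (Subset (suc n))) → Unique F → DistancesIn L F → length F ≤ binomialSum n (length L)
length≤binomialSum {n} {L} L>0 2L≤n F unique dist with length F ℕₚ.≤? binomialSum n (length L)
... | yes F≤ = F≤
... | no  F≰ = contradiction (ℤₚ.<-≤-trans form>0 form≤0) (ℤₚ.<-irrefl refl)
  where
  A : Fin (length F) → Subset (suc n)
  A = lookup F

  -- One test per set of at most `length L` points among the last n; the first coordinate is fixed
  -- by parity, which is why n and not n + 1 is counted.
  tests : List (Subset (suc n))
  tests = map (completeParity (length L)) (subsetsUpTo n (length L))

  rows : List (Vector ℤ (length F))
  rows = map (λ S → χ S ∘ A) tests

  length-rows : length rows ≡ binomialSum n (length L)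
  length-rows = trans (length-map (λ S → χ S ∘ A) tests)
    (trans (length-map (completeParity (length L)) (subsetsUpTo n (length L))) (length-subsetsUpTo n (length L)))

  solution = nontrivialSolution rows (subst (_< length F) (sym length-rows) (ℕₚ.≰⇒> F≰))

  v : Vector ℤ (length F)
  v = proj₁ solution

  K : Kernel (suc n)
  K x y = annihilator L ∣ x △ y ∣

  vanish : ∀ S → ∣ S ∣ ⊑ length L → characterSum A v S ≡ 0ℤ
  vanish (b ∷ S) p = All.lookup (proj₂ (proj₂ solution)) (∈-map⁺ (λ S → χ S ∘ A)
    (subst (_∈ tests) (sym (∷≡completeParity b S p))
      (∈-map⁺ (completeParity (length L)) (∈-subsetsUpTo S (ℕₚ.≤-trans (∣S∣≤∣b∷S∣ b S) (⊑⇒≤ p))))))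

  form≤0 : form A v K ℤ.≤ 0ℤ
  form≤0 = form-nonpos A v (annihilator-alternating 2L≤n) vanish

  -- Distinct members are at a distance in `L`, a root of the annihilator, so only the diagonal, at
  -- distance 0, survives.
  form≡ : form A v K ≡ dot v v ℤ.* annihilator L 0
  form≡ = form-diagonal A v {K}
    (λ i → cong (annihilator L) (∣x△x∣≡0 (A i)))
    (λ i j j≢i → annihilator-root
      (dist (∈-lookup i) (∈-lookup j) (λ eq → j≢i (sym (lookup-injective unique i j eq)))))

  form>0 : 0ℤ ℤ.< form A v K
  form>0 with proj₁ (proj₂ solution)
  ... | i , vᵢ≢0 = subst (0ℤ ℤ.<_) (sym form≡)
    (ℤₚ.*-monoʳ-<-pos (annihilator L 0) {{ℤ.positive (annihilator-pos L>0)}} (dot-self-pos v i vᵢ≢0))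

-- Parity of sets

odd-△ : (A B : Subset n) → odd ∣ A △ B ∣ ≡ odd ∣ A ∣ xor odd ∣ B ∣
odd-△ []          []          = refl
odd-△ (false ∷ A) (false ∷ B) = odd-△ A B
odd-△ (false ∷ A) (true ∷ B)  = trans (cong not (odd-△ A B)) (Boolₚ.not-distribʳ-xor (odd ∣ A ∣) (odd ∣ B ∣))
odd-△ (true ∷ A)  (false ∷ B) = trans (cong not (odd-△ A B)) (Boolₚ.not-distribˡ-xor (odd ∣ A ∣) (odd ∣ B ∣))
odd-△ (true ∷ A)  (true ∷ B)  = trans (odd-△ A B) (not-xor-not (odd ∣ A ∣) (odd ∣ B ∣))
  where
  not-xor-not : ∀ a b → a xor b ≡ not a xor not b
  not-xor-not true  b = refl
  not-xor-not false b = sym (not-involutive b)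

addParityBit : Subset n → Subset (suc n)
addParityBit A = odd ∣ A ∣ ∷ A

-- The parity bits differ exactly when the distance is odd. Even distances are therefore kept, while
-- odd ones grow by one and fall into `odds+1 L`.
∣addParityBit∣ : ∀ {L} → odds+1 L ⊆ evens L → (A B : Subset n) → ∣ A △ B ∣ ∈ L →
  ∣ addParityBit A △ addParityBit B ∣ ∈ evens L
∣addParityBit∣ {L = L} sub A B d∈L with odd ∣ A ∣ | odd ∣ B ∣ | odd-△ A B
... | false | false | par = ∈-filter⁺ (2 ∣?_) d∈L (¬odd⇒2∣ _ par)
... | true  | true  | par = ∈-filter⁺ (2 ∣?_) d∈L (¬odd⇒2∣ _ par)
... | false | true  | par = sub (∈-map⁺ suc (∈-filter⁺ (λ ℓ → ¬? (2 ∣? ℓ)) d∈L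
                              λ 2∣d → contradiction (trans (sym par) (2∣⇒¬odd 2∣d)) λ ()))
... | true  | false | par = sub (∈-map⁺ suc (∈-filter⁺ (λ ℓ → ¬? (2 ∣? ℓ)) d∈L
                              λ 2∣d → contradiction (trans (sym par) (2∣⇒¬odd 2∣d)) λ ()))

hasParity? : ∀ b (A : Subset n) → Dec (odd ∣ A ∣ ≡ b)
hasParity? b A = odd ∣ A ∣ Boolₚ.≟ b

ofParity : Bool → List (Subset n) → List (Subset n)
ofParity b = filter (hasParity? b)

length-ofParity : (F : List (Subset n)) → length F ≡ length (ofParity false F) + length (ofParity true F)
length-ofParity [] = refl
length-ofParity (A ∷ F) with odd ∣ A ∣
... | false = cong suc (length-ofParity F)
... | true  = trans (cong suc (length-ofParity F)) (sym (ℕₚ.+-suc _ _))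

-- Two sets of equal parity are at even distance.
distancesIn-ofParity : ∀ {L} b (F : List (Subset n)) → DistancesIn L F → DistancesIn (evens L) (ofParity b F)
distancesIn-ofParity b F dist {A} {B} A∈ B∈ A≢B with ∈-filter⁻ (hasParity? b) A∈ | ∈-filter⁻ (hasParity? b) B∈
... | A∈F , Apar | B∈F , Bpar = ∈-filter⁺ (2 ∣?_) (dist A∈F B∈F A≢B)
  (¬odd⇒2∣ _ (trans (odd-△ A B) (trans (cong₂ _xor_ Apar Bpar) (Boolₚ.xor-same b))))

-- Assembly of the three bounds

corollary4p3 : (L : List ℕ) → IsFiniteSetOfPositives L →
    ∃[ n₀ ] (∀ n → n₀ ≤ n →
    (F : List (Subset n)) → Unique F → DistancesIn L F →
    (All Even L → length F ≤ binomialSum (n ∸ 1) (length (evens L)))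
    × (¬ All Even L → length F ≤ 2 * binomialSum (n ∸ 1) (length (evens L)))
    × (¬ All Even L → odds+1 L ⊆ evens L →
    length F ≤ binomialSum n (length (evens L))))
-- Twice the maximum gives 2ℓ ≤ n for every ℓ in `L`, with 0 as the maximum of the empty list. The
-- successor excludes n = 0, so `n ∸ 1` is a true predecessor.
corollary4p3 L (_ , L>0) = suc (2 * max 0 L) , bounds
  where
  ∈L : ∀ {ℓ} → ℓ ∈ evens L → ℓ ∈ L
  ∈L = proj₁ ∘ ∈-filter⁻ (2 ∣?_)

  evens>0 : All (0 <_) (evens L)
  evens>0 = All.tabulate (All.lookup L>0 ∘ ∈L)

  evens-bounded : suc (2 * max 0 L) ≤ n → All (λ ℓ → 2 * ℓ ≤ n) (evens L)
  evens-bounded n₀≤n = All.tabulate λ ℓ∈ →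
    ℕₚ.≤-trans (ℕₚ.*-monoʳ-≤ 2 (All.lookup (xs≤max 0 L) (∈L ℓ∈))) (ℕₚ.<⇒≤ n₀≤n)

  bounds : ∀ n → suc (2 * max 0 L) ≤ n → (F : List (Subset n)) → Unique F → DistancesIn L F → _
  bounds (suc n) n₀≤n F unique dist = allEven , (λ _ → general) , (λ _ → closed)
    where
    allEven : All Even L → length F ≤ binomialSum n (length (evens L))
    allEven even = length≤binomialSum evens>0 (evens-bounded n₀≤n) F unique
      λ A∈ B∈ A≢B → ∈-filter⁺ (2 ∣?_) (dist A∈ B∈ A≢B) (All.lookup even (dist A∈ B∈ A≢B))

    half : ∀ b → length (ofParity b F) ≤ binomialSum n (length (evens L))
    half b = length≤binomialSum evens>0 (evens-bounded n₀≤n) (ofParity b F)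
      (Uniqueₚ.filter⁺ (hasParity? b) unique) (distancesIn-ofParity b F dist)

    general : length F ≤ 2 * binomialSum n (length (evens L))
    general = begin
      length F                                                  ≡⟨ length-ofParity F ⟩
      length (ofParity false F) + length (ofParity true F)      ≤⟨ ℕₚ.+-mono-≤ (half false) (half true) ⟩
      b + b                                                     ≡⟨ cong (λ m → b + m) (ℕₚ.+-identityʳ b) ⟨
      2 * b                                                     ∎
      where
      open ℕₚ.≤-Reasoning
      b = binomialSum n (length (evens L))

    closed : odds+1 L ⊆ evens L → length F ≤ binomialSum (suc n) (length (evens L))
    -- The parity bit enlarges the ground set by one point, so the single-family bound now sums over
    -- the original number of points.
    closed sub = subst (_≤ _) (length-map addParityBit F)
      (length≤binomialSum evens>0 (evens-bounded (ℕₚ.m≤n⇒m≤1+n n₀≤n)) (map addParityBit F)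
        (Uniqueₚ.map⁺ ∷-injectiveʳ unique) extended)
      where
      extended : DistancesIn (evens L) (map addParityBit F)
      extended A⁺∈ B⁺∈ A⁺≢B⁺ with ∈-map⁻ addParityBit A⁺∈ | ∈-map⁻ addParityBit B⁺∈
      ... | A , A∈ , refl | B , B∈ , refl =
        ∣addParityBit∣ sub A B (dist A∈ B∈ λ A≡B → A⁺≢B⁺ (cong addParityBit A≡B))
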